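{- There is an infinite class $\Phi$ of CNFs such that every $\varphi \in \Phi$ can be represented by an FBDD of size polynomial in $|\mathsf{var}(\varphi)|$, while every $\wedge_d$-OBDD representing $\varphi$ has size exponential in a power of $|\mathsf{var}(\varphi)|$, i.e. at least $2^{\Omega(|\mathsf{var}(\varphi)|^{c})}$ for some absolute constant $c>0$.
   Context: An assignment ${\bf a}$ is a map from a finite set of variables $\mathsf{var}({\bf a})$ to $\{0,1\}$, identified with the set of pairs $(x,{\bf a}(x))$. For sets $\mathcal{H}_1,\mathcal{H}_2$ of assignments over disjoint variable sets, $\mathcal{H}_1\times\mathcal{H}_2=\{{\bf a}\cup{\bf b}: {\bf a}\in\mathcal{H}_1,{\bf b}\in\mathcal{H}_2\}$. A $\wedge_d$-FBDD is a directed acyclic graph $B$ with a single source and two sinks labelled ${\bf 0}$ and ${\bf 1}$; every non-sink node has two children and is either a conjunction node or a decision node labelled by a variable, whose two outgoing edges are labelled $0$ and $1$. For a node $u$, $B_u$ is the sub-DAG of nodes reachable from $u$, and $\mathsf{var}(B_u)$ is the set of variables labelling decision nodes of $B_u$. It is required that (decomposability) for every conjunction node with children $u_0,u_1$, $\mathsf{var}(B_{u_0})\cap\mathsf{var}(B_{u_1})=\emptyset$, and (read-once) no directed path contains two decision nodes labelled by the same variable. The size $|B|$ is the number of nodes. The set $\mathcal{A}(B)$ of accepted assignments is defined recursively: for a single ${\bf 1}$-sink it is $\{\emptyset\}$, for a single ${\bf 0}$-sink it is $\emptyset$; if the source is a decision node labelled $x$ with $0$-child $u_0$ and $1$-child $u_1$,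 then $\mathcal{A}(B)=\mathcal{A}(B_{u_0})\times\{(x,0)\}\cup\mathcal{A}(B_{u_1})\times\{(x,1)\}$; if the source is a conjunction node with children $u_0,u_1$, then $\mathcal{A}(B)=\mathcal{A}(B_{u_0})\times\mathcal{A}(B_{u_1})$. The function $f(B)$ is the Boolean function on $\mathsf{var}(B)$ whose satisfying assignments are those extending some element of $\mathcal{A}(B)$; $B$ represents a Boolean function $f$ if $f(B)=f$. A CNF $\varphi$ is regarded as a Boolean function on the set $\mathsf{var}(\varphi)$ of variables occurring in it. An FBDD is a $\wedge_d$-FBDD with no conjunction nodes. A $\wedge_d$-OBDD is a $\wedge_d$-FBDD $B$ for which there is a linear order $\pi$ of a superset of $\mathsf{var}(B)$ such that along every directed path the labels of decision nodes appear in increasing $\pi$-order. -}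

module Defs where

open import Data.Nat using (ℕ; zero; suc; _+_; _*_; _^_; _≤_; _<_)
open import Data.Bool using (Bool; true; false; if_then_else_; _∧_; _∨_; not)
open import Data.Maybe using (Maybe; just; nothing)
open import Data.Fin using (Fin; toℕ)
open import Data.List using (List; []; _∷_; map; concat; length; deduplicate)
open import Data.Bool.ListAction using (all; any)
open import Data.List.Membership.Propositional using (_∈_)
open import Data.Product using (Σ; ∃; _×_; _,_; proj₁)
open import Data.Sum using (_⊎_)
open import Data.Empty using (⊥)
open import Relation.Nullary using (¬_)
open import Relation.Binary.PropositionalEquality using (_≡_; _≢_)
open import Function.Definitions using (Injective)
import Data.Nat as ℕ

-- Variables are natural numbers.  A (partial) assignment is a map
-- ℕ → Maybe Bool (nothing = variable not in the domain); all accepted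
-- assignments built below have finite domain.  A total assignment
-- (used to evaluate Boolean functions) is a map ℕ → Bool.

Assignment : Set
Assignment = ℕ → Maybe Bool

TotalAssignment : Set
TotalAssignment = ℕ → Bool

Extends : TotalAssignment → Assignment → Set
Extends τ a = ∀ x b → a x ≡ just b → τ x ≡ b

Literal : Set
Literal = ℕ × Bool

Clause : Set
Clause = List Literal

CNF : Set
CNF = List Clause

evalLit : TotalAssignment → Literal → Bool
evalLit τ (x , true)  = τ x
evalLit τ (x , false) = not (τ x)

evalCNF : CNF → TotalAssignment → Bool
evalCNF φ τ = all (any (evalLit τ)) φ

varList : CNF → List ℕ
varList φ = map proj₁ (concat φ)

InVar : CNF → ℕ → Set
InVar φ x = x ∈ varList φ

nvars : CNF → ℕ
nvars φ = length (deduplicate ℕ._≟_ (varList φ))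

-- ∧_d-FBDDs as DAGs.  The nodes are Fin (suc n); node zero is the source.
-- Each node is a sink (labelled by a Bool), a decision node
-- dec x u₀ u₁ (0-child u₀, 1-child u₁), or a conjunction node conj u₀ u₁.

data Node (m : ℕ) : Set where
  sink : Bool → Node m
  dec  : ℕ → Fin m → Fin m → Node m
  conj : Fin m → Fin m → Node m

ChildN : ∀ {m} → Node m → Fin m → Set
ChildN (sink _)     j = ⊥
ChildN (dec _ a b)  j = j ≡ a ⊎ j ≡ b
ChildN (conj a b)   j = j ≡ a ⊎ j ≡ b

LabelN : ∀ {m} → Node m → ℕ → Set
LabelN (dec y _ _) x = y ≡ x
LabelN (sink _)    x = ⊥
LabelN (conj _ _)  x = ⊥

record Diagram : Set where
  field
    n    : ℕ
    node : Fin (suc n) → Node (suc n)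

open Diagram public

size : Diagram → ℕ
size B = suc (n B)

source : (B : Diagram) → Fin (suc (n B))
source B = Fin.zero
  where import Data.Fin as Fin

Child : (B : Diagram) → Fin (suc (n B)) → Fin (suc (n B)) → Set
Child B i j = ChildN (node B i) j

data Reach (B : Diagram) : Fin (suc (n B)) → Fin (suc (n B)) → Set where
  here  : ∀ {i} → Reach B i i
  there : ∀ {i j k} → Child B i j → Reach B j k → Reach B i k

VarAt : (B : Diagram) → Fin (suc (n B)) → ℕ → Set
VarAt B u x = ∃ λ j → Reach B u j × LabelN (node B j) x

VarB : Diagram → ℕ → Set
VarB B x = VarAt B (source B) x

record IsAndFBDD (B : Diagram) : Set where
  field
    -- acyclic (nodes are numbered in a topological order)
    acyclic      : ∀ i j → Child B i j → toℕ i < toℕ j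
    singleSource : ∀ j → Reach B (source B) j
    sinks        : ∀ i j b → node B i ≡ sink b → node B j ≡ sink b → i ≡ j
    decomposable : ∀ i u₀ u₁ → node B i ≡ conj u₀ u₁ →
                   ∀ x → VarAt B u₀ x → VarAt B u₁ x → ⊥
    readOnce     : ∀ i x u₀ u₁ → node B i ≡ dec x u₀ u₁ →
                   ¬ VarAt B u₀ x × ¬ VarAt B u₁ x

IsFBDD : Diagram → Set
IsFBDD B = IsAndFBDD B × (∀ i u₀ u₁ → node B i ≢ conj u₀ u₁)

-- a ∧_d-OBDD: a ∧_d-FBDD together with a linear order π (given as an
-- injective rank function on all of ℕ, a superset of var(B)) such that
-- along every directed path decision labels appear in increasing π-order.
IsAndOBDD : Diagram → Set
IsAndOBDD B = IsAndFBDD B ×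
  (Σ (ℕ → ℕ) λ π → Injective _≡_ _≡_ π ×
     (∀ i j x y → Reach B i j → i ≢ j →
        LabelN (node B i) x → LabelN (node B j) y → π x < π y))

merge : Maybe Bool → Maybe Bool → Maybe Bool
merge (just v) _ = just v
merge nothing  m = m

data Accepted (B : Diagram) : Fin (suc (n B)) → Assignment → Set where
  acc-one  : ∀ {u a} → node B u ≡ sink true →
             (∀ x → a x ≡ nothing) → Accepted B u a
  acc-dec  : ∀ {u x u₀ u₁ a a′} → node B u ≡ dec x u₀ u₁ →
             (b : Bool) → Accepted B (if b then u₁ else u₀) a′ →
             a′ x ≡ nothing → a x ≡ just b →
             (∀ y → y ≢ x → a y ≡ a′ y) → Accepted B u a
  acc-conj : ∀ {u u₀ u₁ a a₀ a₁} → node B u ≡ conj u₀ u₁ →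
             Accepted B u₀ a₀ → Accepted B u₁ a₁ →
             (∀ x → a₀ x ≡ nothing ⊎ a₁ x ≡ nothing) →
             (∀ x → a x ≡ merge (a₀ x) (a₁ x)) → Accepted B u a

Represents : Diagram → CNF → Set
Represents B φ =
  (∀ x → (VarB B x → InVar φ x) × (InVar φ x → VarB B x)) ×
  (∀ (τ : TotalAssignment) →
     (evalCNF φ τ ≡ true → ∃ λ a → Accepted B (source B) a × Extends τ a) ×
     ((∃ λ a → Accepted B (source B) a × Extends τ a) → evalCNF φ τ ≡ true))

{-# OPTIONS --safe #-}

-- The formula φ has a selector variable and an n × n grid of variables; the selector decides
-- whether some row or some column of the grid is required to consist of ones only.  An FBDD
-- reads the selector and then the grid row by row or column by column.  Sizes are measured against the
-- number of variables only, so φ may be the (exponentially long) canonical CNF.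
--
-- For an order π, let z be the variable at which a line, say a row, is completed first.  Before
-- z every column except the column c of z has been touched, and no column is complete.  Select
-- columns and fix the rest of column c to ones.  For a set S of columns other than c, fill the
-- variables before z in the columns of S with ones and in the others with zeros.  The residual
-- functions differ for different S, and each has the form z ∨ g, so at a conjunction node
-- the child not containing z is constantly true and may be dropped.  Following S from the
-- source thus ends at a node that determines S, and there are at least 2 ^ (n − 1) nodes.

module Submission where

open import Defs
open import Data.Bool using (Bool; true; false; not; if_then_else_; _∧_; _∨_)
open import Data.Bool.ListAction using (any)
import Data.Bool.Properties as Bool
open import Data.Empty using (⊥-elim)
open import Data.Fin as Fin using (Fin; zero; suc; toℕ; fromℕ; fromℕ<; inject₁; punchIn;
  combine; remQuot; splitAt; _↑ˡ_; _↑ʳ_; finToFun; funToFin)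
import Data.Fin.Induction as Fin
import Data.Fin.Properties as Fin
open import Data.Fin.Relation.Unary.Top using (view; ‵fromℕ; ‵inject₁; view-fromℕ; view-inject₁)
open import Data.List using (List; []; _∷_; map; length; lookup; _++_)
open import Data.List.Membership.Propositional using (_∈_)
open import Data.List.Membership.Propositional.Properties
open import Data.List.Relation.Unary.All as All using ()
open import Data.List.Relation.Unary.AllPairs using (_∷_)
open import Data.List.Relation.Unary.Any using (here; there; index)
import Data.List.Relation.Unary.Any.Properties as Any
open import Data.List.Relation.Unary.Unique.DecPropositional.Properties using (deduplicate-!)
open import Data.List.Relation.Unary.Unique.Propositional using (Unique)
open import Data.Maybe using (just; nothing)
open import Data.Maybe.Properties using (just-injective)
open import Data.Nat using (ℕ; zero; suc; _+_; _*_; _^_; _≤_; _<_; _≟_; _<?_; z≤n; s≤s)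
import Data.Nat.Properties as ℕ
open import Data.Product using (Σ; ∃; ∃₂; _×_; _,_; proj₁; proj₂; uncurry)
open import Data.Sum using (_⊎_; inj₁; inj₂; [_,_]′; map₁)
open import Data.Vec.Functional using (insertAt)
open import Data.Vec.Functional.Properties using (insertAt-lookup; insertAt-punchIn)
open import Function using (_∘_; id; flip; _⇔_; mk⇔)
open import Function.Bundles using (module Equivalence)
open import Function.Properties.Equivalence using () renaming (trans to ⇔-trans; sym to ⇔-sym)
open import Induction.WellFounded using (Acc; acc)
open import Relation.Binary.PropositionalEquality
open import Relation.Nullary using (¬_; Dec; yes; no; contradiction; ⌊_⌋)
open import Relation.Nullary.Decidable using (map′; _⊎-dec_)
open Equivalence

-- Point updates of assignments.

infix 8 _[_≔_]

_[_≔_] : ∀ {A : Set} → (ℕ → A) → ℕ → A → ℕ → A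
(τ [ x ≔ b ]) y = if ⌊ y ≟ x ⌋ then b else τ y

update-≡ : ∀ {A : Set} (τ : ℕ → A) x {b} → (τ [ x ≔ b ]) x ≡ b
update-≡ τ x with x ≟ x
... | yes _  = refl
... | no x≢x = contradiction refl x≢x

update-≢ : ∀ {A : Set} (τ : ℕ → A) {x y b} → y ≢ x → (τ [ x ≔ b ]) y ≡ τ y
update-≢ τ {x} {y} y≢x with y ≟ x
... | yes y≡x = contradiction y≡x y≢x
... | no _    = refl

update-self : ∀ {A : Set} (τ : ℕ → A) {x b} → τ x ≡ b → ∀ y → (τ [ x ≔ b ]) y ≡ τ y
update-self τ {x} eq y with y ≟ x
... | yes refl = sym eq
... | no _     = refl

dec-injective : ∀ {m x y} {u₀ u₁ v₀ v₁ : Fin m} → dec x u₀ u₁ ≡ dec y v₀ v₁ →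
                x ≡ y × u₀ ≡ v₀ × u₁ ≡ v₁
dec-injective refl = refl , refl , refl

conj-injective : ∀ {m} {u₀ u₁ v₀ v₁ : Fin m} → conj u₀ u₁ ≡ conj v₀ v₁ →
                 u₀ ≡ v₀ × u₁ ≡ v₁
conj-injective refl = refl , refl

-- Satisfaction of nodes by total assignments.

module _ (B : Diagram) where

  -- `Accepted` and `Extends` fused into evaluation under a single total assignment, so that no
  -- partial domains have to be tracked in the lower bound.
  data Sat (τ : TotalAssignment) : Fin (suc (n B)) → Set where
    sat-one  : ∀ {u} → node B u ≡ sink true → Sat τ u
    sat-dec  : ∀ {u x u₀ u₁} → node B u ≡ dec x u₀ u₁ →
               Sat τ (if τ x then u₁ else u₀) → Sat τ u
    sat-conj : ∀ {u u₀ u₁} → node B u ≡ conj u₀ u₁ →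
               Sat τ u₀ → Sat τ u₁ → Sat τ u

module _ {B : Diagram} where

  sat-dec⁻ : ∀ {τ u x u₀ u₁} → node B u ≡ dec x u₀ u₁ →
             Sat B τ u → Sat B τ (if τ x then u₁ else u₀)
  sat-dec⁻ e (sat-one e′) with () ← trans (sym e) e′
  sat-dec⁻ e (sat-dec e′ p) with refl , refl , refl ← dec-injective (trans (sym e) e′) = p
  sat-dec⁻ e (sat-conj e′ _ _) with () ← trans (sym e) e′

  sat-conj⁻ : ∀ {τ u u₀ u₁} → node B u ≡ conj u₀ u₁ →
              Sat B τ u → Sat B τ u₀ × Sat B τ u₁
  sat-conj⁻ e (sat-one e′) with () ← trans (sym e) e′
  sat-conj⁻ e (sat-dec e′ _) with () ← trans (sym e) e′
  sat-conj⁻ e (sat-conj e′ p q) with refl , refl ← conj-injective (trans (sym e) e′) = p , q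

  dec-child : ∀ {u x u₀ u₁} → node B u ≡ dec x u₀ u₁ → ∀ b → Child B u (if b then u₁ else u₀)
  dec-child e false rewrite e = inj₁ refl
  dec-child e true  rewrite e = inj₂ refl

  conj-child₀ : ∀ {u u₀ u₁} → node B u ≡ conj u₀ u₁ → Child B u u₀
  conj-child₀ e rewrite e = inj₁ refl

  conj-child₁ : ∀ {u u₀ u₁} → node B u ≡ conj u₀ u₁ → Child B u u₁
  conj-child₁ e rewrite e = inj₂ refl

  varAt-child : ∀ {u v x} → Child B u v → VarAt B v x → VarAt B u x
  varAt-child c (j , r , l) = j , there c r , l

  varAt-label : ∀ {u x u₀ u₁} → node B u ≡ dec x u₀ u₁ → VarAt B u x
  varAt-label {u} {x} e = u , here , subst (λ N → LabelN N x) (sym e) refl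

  varAt⁻ : ∀ {u x} → VarAt B u x →
           LabelN (node B u) x ⊎ ∃ λ v → Child B u v × VarAt B v x
  varAt⁻ (j , here , l)      = inj₁ l
  varAt⁻ (j , there c r , l) = inj₂ (_ , c , j , r , l)

  sat-cong : ∀ {τ τ′ u} → (∀ x → VarAt B u x → τ x ≡ τ′ x) → Sat B τ u → Sat B τ′ u
  sat-cong eq (sat-one e) = sat-one e
  sat-cong {τ} {τ′} eq (sat-dec {x = x} {u₀} {u₁} e p) =
    sat-dec e (subst (λ b → Sat B τ′ (if b then u₁ else u₀)) (eq x (varAt-label e))
      (sat-cong (λ y m → eq y (varAt-child (dec-child e (τ x)) m)) p))
  sat-cong eq (sat-conj e p q) =
    sat-conj e (sat-cong (λ y m → eq y (varAt-child (conj-child₀ e) m)) p)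
               (sat-cong (λ y m → eq y (varAt-child (conj-child₁ e) m)) q)

  -- An extension of `a` also extends the parts from which `a` is built: `a′` is undefined at the
  -- decided variable, and disjointness makes `merge` keep both `a₀` and `a₁`.
  accepted⇒sat : ∀ {τ u a} → Accepted B u a → Extends τ a → Sat B τ u
  accepted⇒sat (acc-one e _) ext = sat-one e
  accepted⇒sat {τ} (acc-dec {x = x} {u₀} {u₁} {a} {a′} e b p a′x ax a≗a′) ext =
    sat-dec e (subst (λ b → Sat B τ (if b then u₁ else u₀)) (sym (ext x b ax))
      (accepted⇒sat p ext′))
    where
    ext′ : Extends τ a′
    ext′ y b a′y with y ≟ x
    ... | yes refl with () ← trans (sym a′y) a′x
    ... | no y≢x = ext y b (trans (a≗a′ y y≢x) a′y)
  accepted⇒sat {τ} (acc-conj {a = a} {a₀} {a₁} e p q disj a≗) ext =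
    sat-conj e (accepted⇒sat p ext₀) (accepted⇒sat q ext₁)
    where
    ext₀ : Extends τ a₀
    ext₀ x b a₀x = ext x b (trans (a≗ x) (cong (λ w → merge w (a₁ x)) a₀x))

    ext₁ : Extends τ a₁
    ext₁ x b a₁x with disj x
    ... | inj₁ a₀x = ext x b (trans (a≗ x) (trans (cong (λ w → merge w (a₁ x)) a₀x) a₁x))
    ... | inj₂ a₁x′ with () ← trans (sym a₁x) a₁x′

  module _ (B-fbdd : IsAndFBDD B) where
    open IsAndFBDD B-fbdd

    -- The accepted part is `τ` restricted to what is read. The bound of its domain by `VarAt`
    -- strengthens the induction: read-once then gives `a′ x ≡ nothing`, and decomposability gives
    -- disjoint domains at conjunctions.
    sat⇒accepted : ∀ {τ u} → Sat B τ u → ∃ λ a →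
      Accepted B u a × Extends τ a × (∀ x b → a x ≡ just b → VarAt B u x)
    sat⇒accepted (sat-one e) =
      (λ _ → nothing) , acc-one e (λ _ → refl) , (λ _ _ ()) , (λ _ _ ())
    sat⇒accepted {τ} {u} (sat-dec {x = x} {u₀} {u₁} e p)
      with a′ , p′ , ext , dom ← sat⇒accepted p =
      a , acc-dec e (τ x) p′ a′x (update-≡ a′ x) (λ y → update-≢ a′) , ext′ , dom′
      where
      a = a′ [ x ≔ just (τ x) ]

      x∉ : ∀ b → ¬ VarAt B (if b then u₁ else u₀) x
      x∉ false = proj₁ (readOnce _ _ _ _ e)
      x∉ true  = proj₂ (readOnce _ _ _ _ e)

      a′x : a′ x ≡ nothing
      a′x with a′ x in eq
      ... | nothing = refl
      ... | just b  = contradiction (dom x b eq) (x∉ (τ x))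

      ext′ : Extends τ a
      ext′ y b ay with y ≟ x
      ... | yes refl = just-injective ay
      ... | no _     = ext y b ay

      dom′ : ∀ y b → a y ≡ just b → VarAt B u y
      dom′ y b ay with y ≟ x
      ... | yes refl = varAt-label e
      ... | no _     = varAt-child (dec-child e (τ x)) (dom y b ay)
    sat⇒accepted {τ} {u} (sat-conj {u₀ = u₀} {u₁} e p q)
      with a₀ , p′ , ext₀ , dom₀ ← sat⇒accepted p
         | a₁ , q′ , ext₁ , dom₁ ← sat⇒accepted q =
      a , acc-conj e p′ q′ disj (λ _ → refl) , ext , dom
      where
      a : Assignment
      a x = merge (a₀ x) (a₁ x)

      disj : ∀ x → a₀ x ≡ nothing ⊎ a₁ x ≡ nothing
      disj x with a₀ x in eq₀ | a₁ x in eq₁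
      ... | nothing | _       = inj₁ refl
      ... | just _  | nothing = inj₂ refl
      ... | just b  | just b′ =
        ⊥-elim (decomposable _ _ _ e x (dom₀ x b eq₀) (dom₁ x b′ eq₁))

      ext : Extends τ a
      ext x b ax with a₀ x in eq₀
      ... | nothing = ext₁ x b ax
      ... | just _  = ext₀ x b (trans eq₀ ax)

      dom : ∀ x b → a x ≡ just b → VarAt B u x
      dom x b ax with a₀ x in eq₀
      ... | nothing = varAt-child (conj-child₁ e) (dom₁ x b ax)
      ... | just b₀ = varAt-child (conj-child₀ e) (dom₀ x b₀ eq₀)

    -- Recursion along the topological numbering. The walk below uses it to decide which child of a
    -- conjunction node to keep.
    varAt? : ∀ u x → Dec (VarAt B u x)
    varAt? u x = go u (Fin.>-wellFounded u)
      where
      label? : ∀ {m} (N : Node m) → Dec (LabelN N x)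
      label? (sink _)    = no λ ()
      label? (dec y _ _) = y ≟ x
      label? (conj _ _)  = no λ ()

      go : ∀ u → Acc Fin._>_ u → Dec (VarAt B u x)
      go u (acc rec) =
        map′ (λ where (inj₁ l)             → u , here , l
                      (inj₂ (v , c , m)) → varAt-child c m)
             varAt⁻
             (label? (node B u) ⊎-dec any-child)
        where
        below : ∀ {v} → Child B u v → Dec (VarAt B v x)
        below {v} c = go v (rec (acyclic u v c))

        any-child : Dec (∃ λ v → Child B u v × VarAt B v x)
        any-child with node B u in e
        ... | sink _ = no λ ()
        ... | dec _ u₀ u₁ =
          map′ (λ where (inj₁ m) → u₀ , inj₁ refl , m
                        (inj₂ m) → u₁ , inj₂ refl , m)
               (λ where (_ , inj₁ refl , m) → inj₁ m
                        (_ , inj₂ refl , m) → inj₂ m)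
               (below (dec-child e false) ⊎-dec below (dec-child e true))
        ... | conj u₀ u₁ =
          map′ (λ where (inj₁ m) → u₀ , inj₁ refl , m
                        (inj₂ m) → u₁ , inj₂ refl , m)
               (λ where (_ , inj₁ refl , m) → inj₁ m
                        (_ , inj₂ refl , m) → inj₂ m)
               (below (conj-child₀ e) ⊎-dec below (conj-child₁ e))

  -- The walk to a node that reads only late variables.

  module Walk
    (B-fbdd : IsAndFBDD B) (π : ℕ → ℕ)
    (ordered : ∀ i j x y → Reach B i j → i ≢ j →
               LabelN (node B i) x → LabelN (node B j) y → π x < π y)
    (F : TotalAssignment → Set) (z : ℕ) (C : TotalAssignment → Set)
    (ρ : TotalAssignment)
    (C⇒ρ : ∀ {τ} → C τ → ∀ {x} → π x < π z → τ x ≡ ρ x)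
    (C-z : ∀ {τ} → C τ → C (τ [ z ≔ true ]))
    (F-z : ∀ {τ} → C τ → F (τ [ z ≔ true ]))
    where
    open IsAndFBDD B-fbdd

    Late : Fin (suc (n B)) → Set
    Late u = ∀ x → VarAt B u x → π z ≤ π x

    -- Agreement with `F` is demanded on `C` only, since following `ρ` and dropping conjuncts may
    -- change the function elsewhere.
    Computes : Fin (suc (n B)) → Set
    Computes u = ∀ {τ} → C τ → Sat B τ u ⇔ F τ

    -- Setting z to true satisfies u, hence both children; the child without z is then
    -- satisfied by every assignment in C.
    computes-conj : ∀ {u u₀ u₁} → Computes u → ¬ VarAt B u₁ z →
                    (∀ {τ} → Sat B τ u → Sat B τ u₀ × Sat B τ u₁) →
                    (∀ {τ} → Sat B τ u₀ → Sat B τ u₁ → Sat B τ u) → Computes u₀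
    computes-conj {u} {u₀} {u₁} comp z∉ split join {τ} cτ =
      mk⇔ (λ p → to (comp cτ) (join p sat₁)) (λ q → proj₁ (split (from (comp cτ) q)))
      where
      sat₁ : Sat B τ u₁
      sat₁ = sat-cong (λ x m → update-≢ τ λ { refl → z∉ m })
               (proj₂ (split (from (comp (C-z cτ)) (F-z cτ))))

    -- A decision before `z` is left along `ρ`, with which all of `C` agrees; a conjunction is left
    -- for a child that alone computes `F` on `C`. The walk stops at a sink or at a decision of rank
    -- at least `π z`, and the order makes everything beneath it late as well.
    walk : ∀ u → Computes u → ∃ λ v → Late v × Computes v
    walk u = go u (Fin.>-wellFounded u)
      where
      go : ∀ u → Acc Fin._>_ u → Computes u → ∃ λ v → Late v × Computes v
      go u (acc rec) comp with node B u in e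
      ... | sink _ = u , late , comp
        where
        late : Late u
        late x m with varAt⁻ m
        ... | inj₁ l rewrite e = ⊥-elim l
        ... | inj₂ (_ , c , _) rewrite e = ⊥-elim c
      ... | dec x u₀ u₁ with π x <? π z
      ... | no x≮z = u , late , comp
        where
        late : Late u
        late y (j , r , l) with u Fin.≟ j
        ... | yes refl with refl ← subst (λ N → LabelN N y) e l = ℕ.≮⇒≥ x≮z
        ... | no u≢j = ℕ.≤-trans (ℕ.≮⇒≥ x≮z) (ℕ.<⇒≤ (ordered u j x y r u≢j
                         (subst (λ N → LabelN N x) (sym e) refl) l))
      ... | yes x<z = go v (rec (acyclic u v (dec-child e (ρ x)))) comp′
        where
        v = if ρ x then u₁ else u₀

        comp′ : Computes v
        comp′ {τ} cτ = subst (λ b → Sat B τ (if b then u₁ else u₀) ⇔ F τ) (C⇒ρ cτ x<z)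
          (mk⇔ (λ p → to (comp cτ) (sat-dec e p)) (λ q → sat-dec⁻ e (from (comp cτ) q)))
      go u (acc rec) comp | conj u₀ u₁ with varAt? B-fbdd u₀ z
      ... | yes z∈₀ = go u₀ (rec (acyclic u u₀ (conj-child₀ e)))
        (computes-conj comp (decomposable _ _ _ e z z∈₀) (sat-conj⁻ e) (sat-conj e))
      -- This also covers `z` in neither child: the dropped child `u₀` avoids `z`.
      ... | no z∉₀ = go u₁ (rec (acyclic u u₁ (conj-child₁ e)))
        (computes-conj comp z∉₀ (λ p → let q , r = sat-conj⁻ e p in r , q)
          (λ p q → sat-conj e q p))

-- Bits and codes of subsets.

bit : Bool → Fin 2
bit false = zero
bit true  = suc zero

unbit : Fin 2 → Bool
unbit zero    = false
unbit (suc _) = true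

unbit-bit : ∀ b → unbit (bit b) ≡ b
unbit-bit false = refl
unbit-bit true  = refl

bit-unbit : ∀ i → bit (unbit i) ≡ i
bit-unbit zero       = refl
bit-unbit (suc zero) = refl

-- Phrased by two implications because subsets are compared by mutual inclusion.
unbit-injective : ∀ {i j} → (unbit i ≡ true → unbit j ≡ true) → (unbit j ≡ true → unbit i ≡ true) → i ≡ j
unbit-injective {zero}     {zero}     _ _ = refl
unbit-injective {zero}     {suc zero} _ g with () ← g refl
unbit-injective {suc zero} {zero}     f _ with () ← f refl
unbit-injective {suc zero} {suc zero} _ _ = refl

funToFin-cong : ∀ {a b} {f g : Fin a → Fin b} → (∀ i → f i ≡ g i) → funToFin f ≡ funToFin g
funToFin-cong {zero}  eq = refl
funToFin-cong {suc a} eq = cong₂ Fin.combine (eq zero) (funToFin-cong (eq ∘ suc))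

-- Distinct end nodes for distinct subsets of lines.

module LowerBound
  {m : ℕ} (s : ℕ) (v : Fin (suc m) → Fin (suc m) → ℕ)
  (v-injective : ∀ {k i i′} → v k i ≡ v k i′ → i ≡ i′)
  (s≢v : ∀ {k i} → s ≢ v k i)
  (assign : Bool → (Fin (suc m) → Fin (suc m) → Bool) → TotalAssignment)
  (assign-s : ∀ b g → assign b g s ≡ b)
  (assign-v : ∀ b g k i → assign b g (v k i) ≡ g k i)
  (F : TotalAssignment → Set) (sel : Bool)
  (F-sel : ∀ {τ} → τ s ≡ sel → F τ ⇔ ∃ λ k → ∀ i → τ (v k i) ≡ true)
  (B : Diagram) (B-fbdd : IsAndFBDD B)
  (B-F : ∀ τ → Sat B τ (source B) ⇔ F τ)
  (π : ℕ → ℕ)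
  (ordered : ∀ i j x y → Reach B i j → i ≢ j →
             LabelN (node B i) x → LabelN (node B j) y → π x < π y)
  (c r : Fin (suc m))
  (touched : ∀ k → k ≢ c → ∃ λ i → π (v k i) < π (v c r))
  (incomplete : ∀ k → ∃ λ i → π (v c r) ≤ π (v k i))
  where

  private
    z = v c r

  -- Every line is filled uniformly, so any one early variable of line `k` reveals `S k`.
  early : (Fin (suc m) → Bool) → TotalAssignment
  early S = assign sel (λ k _ → S k)

  -- Chosen so that only line `k` can still consist of ones: line `c` fails exactly at `z`, and each
  -- further line is zero.
  late-grid : Fin (suc m) → Fin (suc m) → Fin (suc m) → Bool
  late-grid k j i = if ⌊ j Fin.≟ c ⌋ then not ⌊ i Fin.≟ r ⌋ else ⌊ j Fin.≟ k ⌋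

  late-grid-z : ∀ k → late-grid k c r ≡ false
  late-grid-z k with c Fin.≟ c | r Fin.≟ r
  ... | no c≢c | _      = contradiction refl c≢c
  ... | yes _  | no r≢r = contradiction refl r≢r
  ... | yes _  | yes _  = refl

  late-grid-c : ∀ k {i} → i ≢ r → late-grid k c i ≡ true
  late-grid-c k {i} i≢r with c Fin.≟ c | i Fin.≟ r
  ... | no c≢c | _       = contradiction refl c≢c
  ... | yes _  | yes i≡r = contradiction i≡r i≢r
  ... | yes _  | no _    = refl

  late-grid-≢ : ∀ {k j} i → j ≢ c → j ≢ k → late-grid k j i ≡ false
  late-grid-≢ {k} {j} i j≢c j≢k with j Fin.≟ c | j Fin.≟ k
  ... | yes j≡c | _       = contradiction j≡c j≢c
  ... | no _    | yes j≡k = contradiction j≡k j≢k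
  ... | no _    | no _    = refl

  late-grid-k : ∀ {k} i → k ≢ c → late-grid k k i ≡ true
  late-grid-k {k} i k≢c with k Fin.≟ c | k Fin.≟ k
  ... | yes k≡c | _      = contradiction k≡c k≢c
  ... | no _    | no k≢k = contradiction refl k≢k
  ... | no _    | yes _  = refl

  late : Fin (suc m) → TotalAssignment
  late k = assign sel (late-grid k)

  -- A fooling assignment: before `z` it depends only on `S`, from `z` on only on `k`.
  test : (Fin (suc m) → Bool) → Fin (suc m) → TotalAssignment
  test S k x = if ⌊ π x <? π z ⌋ then early S x else late k x

  test-early : ∀ S k {x} → π x < π z → test S k x ≡ early S x
  test-early S k {x} lt with π x <? π z
  ... | yes _ = refl
  ... | no ≮  = contradiction lt ≮

  test-late : ∀ S k {x} → π z ≤ π x → test S k x ≡ late k x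
  test-late S k {x} le with π x <? π z
  ... | yes lt = contradiction lt (ℕ.≤⇒≯ le)
  ... | no _   = refl

  test-s : ∀ S k → test S k s ≡ sel
  test-s S k with π s <? π z
  ... | yes _ = assign-s sel _
  ... | no _  = assign-s sel _

  -- The selector is fixed separately because it may come after `z`. The value of `z` stays free,
  -- and raising it completes line `c`.
  C : (Fin (suc m) → Bool) → TotalAssignment → Set
  C S τ = τ s ≡ sel × (∀ i → i ≢ r → τ (v c i) ≡ true) ×
          (∀ {x} → π x < π z → τ x ≡ early S x)

  test∈C : ∀ S → S c ≡ true → ∀ k → C S (test S k)
  test∈C S Sc k = test-s S k , on-c , test-early S k
    where
    on-c : ∀ i → i ≢ r → test S k (v c i) ≡ true
    on-c i i≢r with π (v c i) <? π z
    ... | yes _ = trans (assign-v sel _ c i) Sc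
    ... | no _  = trans (assign-v sel _ c i) (late-grid-c k i≢r)

  C-z : ∀ S {τ} → C S τ → C S (τ [ z ≔ true ])
  C-z S {τ} (τs , τc , τρ) =
    trans (update-≢ τ s≢v) τs ,
    (λ i i≢r → trans (update-≢ τ (i≢r ∘ v-injective)) (τc i i≢r)) ,
    (λ lt → trans (update-≢ τ (λ { refl → ℕ.<-irrefl refl lt })) (τρ lt))

  F-z : ∀ S {τ} → C S τ → F (τ [ z ≔ true ])
  F-z S {τ} cτ@(τs , τc , _) =
    from (F-sel (proj₁ (C-z S cτ))) (c , on-c)
    where
    on-c : ∀ i → (τ [ z ≔ true ]) (v c i) ≡ true
    on-c i with i Fin.≟ r
    ... | yes refl = update-≡ τ z
    ... | no i≢r   = proj₁ (proj₂ (C-z S cτ)) i i≢r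

  -- The line of ones can only be `k`: line `c` has a zero at `z`, and any other line has one at the
  -- variable given by `incomplete`. The early variable given by `touched` then reads off `S k`.
  F-test⇒ : ∀ S {k} → k ≢ c → F (test S k) → S k ≡ true
  F-test⇒ S {k} k≢c p with to (F-sel (test-s S k)) p
  ... | j , ones with j Fin.≟ c
  ... | yes refl = contradiction (trans (sym (ones r)) z-false) λ ()
    where
    z-false : test S k z ≡ false
    z-false = trans (test-late S k ℕ.≤-refl) (trans (assign-v sel _ c r) (late-grid-z k))
  ... | no j≢c with j Fin.≟ k
  ... | yes refl = let i , lt = touched k k≢c in
    trans (sym (assign-v sel _ k i)) (trans (sym (test-early S k lt)) (ones i))
  ... | no j≢k = contradiction (trans (sym (ones i)) j-false) λ ()
    where
    i = proj₁ (incomplete j)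
    j-false : test S k (v j i) ≡ false
    j-false = trans (test-late S k (proj₂ (incomplete j)))
                (trans (assign-v sel _ j i) (late-grid-≢ i j≢c j≢k))

  ⇒F-test : ∀ S {k} → k ≢ c → S k ≡ true → F (test S k)
  ⇒F-test S {k} k≢c Sk = from (F-sel (test-s S k)) (k , ones)
    where
    ones : ∀ i → test S k (v k i) ≡ true
    ones i with π (v k i) <? π z
    ... | yes _ = trans (assign-v sel _ k i) Sk
    ... | no _  = trans (assign-v sel _ k i) (late-grid-k i k≢c)

  end : ∀ S → ∃ λ u → (∀ x → VarAt B u x → π z ≤ π x) ×
                      (∀ {τ} → C S τ → Sat B τ u ⇔ F τ)
  end S = W.walk (source B) (λ {τ} _ → B-F τ)
    where
    module W = Walk B-fbdd π ordered F z (C S) (early S)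
                 (λ cτ → proj₂ (proj₂ cτ)) (C-z S) (F-z S)

  -- A common end node reads only late variables, on which `test S k` and `test S′ k` coincide. So
  -- it is satisfied by both or by neither, and the value of `F` carries over.
  end-injective : ∀ S S′ → S c ≡ true → S′ c ≡ true → proj₁ (end S) ≡ proj₁ (end S′) →
                  ∀ {k} → k ≢ c → S k ≡ true → S′ k ≡ true
  end-injective S S′ Sc S′c eq {k} k≢c Sk =
    F-test⇒ S′ k≢c (to (proj₂ (proj₂ (end S′)) (test∈C S′ S′c k))
      (subst (Sat B (test S′ k)) eq
        (sat-cong (λ x m → let le = proj₁ (proj₂ (end S)) x m in
                     trans (test-late S k le) (sym (test-late S′ k le)))
          (from (proj₂ (proj₂ (end S)) (test∈C S Sc k)) (⇒F-test S k≢c Sk)))))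

  -- The entry at `c` is pinned to true, as `test∈C` demands; this leaves `m` free bits.
  select : Fin (2 ^ m) → Fin (suc m) → Bool
  select t = insertAt (unbit ∘ finToFun t) c true

  select-c : ∀ t → select t c ≡ true
  select-c t = insertAt-lookup (unbit ∘ finToFun t) c true

  select-≢ : ∀ t k → select t (punchIn c k) ≡ unbit (finToFun t k)
  select-≢ t k = insertAt-punchIn (unbit ∘ finToFun t) c true k

  lower-bound : 2 ^ m ≤ size B
  lower-bound = Fin.injective⇒≤ {f = λ t → proj₁ (end (select t))} λ {t} {t′} eq →
    trans (sym (Fin.funToFin-finToFin {m} {2} t))
      (trans (funToFin-cong λ k → unbit-injective (incl t t′ eq k) (incl t′ t (sym eq) k))
        (Fin.funToFin-finToFin {m} {2} t′))
    where
    incl : ∀ t t′ → proj₁ (end (select t)) ≡ proj₁ (end (select t′)) →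
           ∀ k → unbit (finToFun t k) ≡ true → unbit (finToFun t′ k) ≡ true
    incl t t′ eq k b = trans (sym (select-≢ t′ k))
      (end-injective (select t) (select t′) (select-c t) (select-c t′) eq
        (Fin.punchInᵢ≢i c k) (trans (select-≢ t k) b))

-- Canonical CNFs by Shannon expansion

canonicalCNF : ℕ → (TotalAssignment → Bool) → CNF
-- By now every variable on which `f` depends has been fixed, so any point may be sampled.
canonicalCNF zero    f = if f (λ _ → false) then [] else [] ∷ []
canonicalCNF (suc N) f = map ((N , true) ∷_)  (canonicalCNF N (λ τ → f (τ [ N ≔ false ]))) ++
                         map ((N , false) ∷_) (canonicalCNF N (λ τ → f (τ [ N ≔ true ])))

DependsBelow : ℕ → (TotalAssignment → Bool) → Set
DependsBelow N f = ∀ {τ τ′} → (∀ x → x < N → τ x ≡ τ′ x) → f τ ≡ f τ′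

dependsBelow-restrict : ∀ {N f b} → DependsBelow (suc N) f → DependsBelow N (λ τ → f (τ [ N ≔ b ]))
dependsBelow-restrict {N} {b = b} dep {τ} {τ′} eq = dep agree
  where
  agree : ∀ x → x < suc N → (τ [ N ≔ b ]) x ≡ (τ′ [ N ≔ b ]) x
  agree x x≤N with x ≟ N
  ... | yes _  = refl
  ... | no x≢N = eq x (ℕ.≤∧≢⇒< (ℕ.≤-pred x≤N) x≢N)

evalCNF-++ : ∀ φ ψ τ → evalCNF (φ ++ ψ) τ ≡ evalCNF φ τ ∧ evalCNF ψ τ
evalCNF-++ []      ψ τ = refl
evalCNF-++ (c ∷ φ) ψ τ =
  trans (cong (any (evalLit τ) c ∧_) (evalCNF-++ φ ψ τ)) (sym (Bool.∧-assoc (any (evalLit τ) c) _ _))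

evalCNF-∷ : ∀ l φ τ → evalCNF (map (l ∷_) φ) τ ≡ evalLit τ l ∨ evalCNF φ τ
evalCNF-∷ l []      τ = sym (Bool.∨-zeroʳ (evalLit τ l))
evalCNF-∷ l (c ∷ φ) τ =
  trans (cong ((evalLit τ l ∨ any (evalLit τ) c) ∧_) (evalCNF-∷ l φ τ))
        (sym (Bool.∨-distribˡ-∧ (evalLit τ l) _ _))

canonicalCNF-correct : ∀ N {f} → DependsBelow N f → ∀ τ → evalCNF (canonicalCNF N f) τ ≡ f τ
canonicalCNF-correct zero {f} dep τ with f (λ _ → false) in eq
... | true  = trans (sym eq) (dep λ _ ())
... | false = trans (sym eq) (dep λ _ ())
canonicalCNF-correct (suc N) {f} dep τ
  rewrite evalCNF-++ (map ((N , true) ∷_) (canonicalCNF N (λ τ → f (τ [ N ≔ false ]))))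
                     (map ((N , false) ∷_) (canonicalCNF N (λ τ → f (τ [ N ≔ true ])))) τ
        | evalCNF-∷ (N , true) (canonicalCNF N (λ τ → f (τ [ N ≔ false ]))) τ
        | evalCNF-∷ (N , false) (canonicalCNF N (λ τ → f (τ [ N ≔ true ]))) τ
        | canonicalCNF-correct N {λ τ → f (τ [ N ≔ false ])} (dependsBelow-restrict dep) τ
        | canonicalCNF-correct N {λ τ → f (τ [ N ≔ true ])} (dependsBelow-restrict dep) τ
  = cases (τ N) refl
  where
  same : ∀ b → τ N ≡ b → f (τ [ N ≔ b ]) ≡ f τ
  same b eq = dep λ x _ → update-self τ eq x

  cases : ∀ b → τ N ≡ b →
          (b ∨ f (τ [ N ≔ false ])) ∧ (not b ∨ f (τ [ N ≔ true ])) ≡ f τ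
  cases true  eq = same true eq
  cases false eq = trans (Bool.∧-identityʳ _) (same false eq)

-- Variables of canonical CNFs.

∈-varList⁺ : ∀ {φ : CNF} {c x} → c ∈ φ → x ∈ map proj₁ c → x ∈ varList φ
∈-varList⁺ c∈φ x∈c with l , l∈c , refl ← ∈-map⁻ proj₁ x∈c = ∈-map⁺ proj₁ (∈-concat⁺′ l∈c c∈φ)

∈-varList⁻ : ∀ (φ : CNF) {x} → x ∈ varList φ → ∃ λ c → c ∈ φ × x ∈ map proj₁ c
∈-varList⁻ φ x∈φ with l , l∈φ , refl ← ∈-map⁻ proj₁ x∈φ
                 with c , l∈c , c∈φ ← ∈-concat⁻′ φ l∈φ = c , c∈φ , ∈-map⁺ proj₁ l∈c

-- This is the clause that excludes `τ`. It mentions all variables below `N`, so one falsifying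
-- assignment suffices to make every variable occur.
canonicalCNF-clause : ∀ N {f} → DependsBelow N f → ∀ {τ} → f τ ≡ false →
  ∃ λ c → c ∈ canonicalCNF N f × (∀ x → x < N → x ∈ map proj₁ c)
canonicalCNF-clause zero {f} dep {τ} fτ
  rewrite trans (dep {λ _ → false} {τ} (λ _ ())) fτ = [] , here refl , λ _ ()
canonicalCNF-clause (suc N) {f} dep {τ} fτ = go (τ N) refl
  where
  restricted : ∀ b → τ N ≡ b → f (τ [ N ≔ b ]) ≡ false
  restricted b eq = trans (dep λ x _ → update-self τ eq x) fτ

  extend : ∀ {c b} → (∀ x → x < N → x ∈ map proj₁ c) →
           ∀ x → x < suc N → x ∈ map proj₁ ((N , b) ∷ c)
  extend h x x≤N with x ≟ N
  ... | yes refl = here refl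
  ... | no x≢N   = there (h x (ℕ.≤∧≢⇒< (ℕ.≤-pred x≤N) x≢N))

  go : ∀ b → τ N ≡ b → ∃ λ c → c ∈ canonicalCNF (suc N) f × (∀ x → x < suc N → x ∈ map proj₁ c)
  go false eq with c , c∈ , h ← canonicalCNF-clause N {λ τ → f (τ [ N ≔ false ])}
                                  (dependsBelow-restrict dep) {τ} (restricted false eq) =
    (N , true) ∷ c , ∈-++⁺ˡ (∈-map⁺ _ c∈) , extend {c} {true} h
  go true eq with c , c∈ , h ← canonicalCNF-clause N {λ τ → f (τ [ N ≔ true ])}
                                 (dependsBelow-restrict dep) {τ} (restricted true eq) =
    (N , false) ∷ c , ∈-++⁺ʳ _ (∈-map⁺ _ c∈) , extend {c} {false} h

canonicalCNF-below : ∀ N f {c x} → c ∈ canonicalCNF N f → x ∈ map proj₁ c → x < N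
canonicalCNF-below zero f c∈ x∈ with f (λ _ → false)
canonicalCNF-below zero f (here refl) () | false
canonicalCNF-below (suc N) f c∈ x∈
  with ∈-++⁻ (map ((N , true) ∷_) (canonicalCNF N _)) c∈
... | inj₁ c∈′ with c′ , c′∈ , refl ← ∈-map⁻ _ c∈′ with x∈
...   | here refl = ℕ.≤-refl
...   | there x∈′ = ℕ.m≤n⇒m≤1+n (canonicalCNF-below N _ c′∈ x∈′)
canonicalCNF-below (suc N) f c∈ x∈
    | inj₂ c∈′ with c′ , c′∈ , refl ← ∈-map⁻ _ c∈′ with x∈
...   | here refl = ℕ.≤-refl
...   | there x∈′ = ℕ.m≤n⇒m≤1+n (canonicalCNF-below N _ c′∈ x∈′)

canonicalCNF-vars : ∀ N {f} → DependsBelow N f → ∀ {τ} → f τ ≡ false →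
  ∀ x → InVar (canonicalCNF N f) x ⇔ x < N
canonicalCNF-vars N {f} dep {τ} fτ x with c , c∈ , h ← canonicalCNF-clause N {f} dep {τ} fτ =
  mk⇔ (λ x∈ → let c , c∈ , x∈c = ∈-varList⁻ (canonicalCNF N f) x∈ in canonicalCNF-below N f c∈ x∈c)
      (λ x<N → ∈-varList⁺ c∈ (h x x<N))

lookup-injective : ∀ {xs : List ℕ} → Unique xs → ∀ {i j} → lookup xs i ≡ lookup xs j → i ≡ j
lookup-injective (_ ∷ _)  {zero}  {zero}  _  = refl
lookup-injective (x∉ ∷ _) {zero}  {suc j} eq = contradiction eq (All.lookup x∉ (∈-lookup j))
lookup-injective (x∉ ∷ _) {suc i} {zero}  eq = contradiction (sym eq) (All.lookup x∉ (∈-lookup i))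
lookup-injective (_ ∷ u)  {suc i} {suc j} eq = cong suc (lookup-injective u eq)

-- Injections in both directions between the positions of `xs` and `Fin N`.
unique-length : ∀ {xs N} → Unique xs → (∀ x → x ∈ xs ⇔ x < N) → length xs ≡ N
unique-length {xs} {N} u h = ℕ.≤-antisym
  (Fin.injective⇒≤ {f = λ i → fromℕ< (to (h _) (∈-lookup i))}
    λ {i} {j} eq → lookup-injective u (Fin.fromℕ<-injective _ _ _ _ eq))
  (Fin.injective⇒≤ {f = λ i → index (position i)}
    λ {i} {j} eq → Fin.toℕ-injective (trans (Any.lookup-index (position i))
      (trans (cong (lookup xs) eq) (sym (Any.lookup-index (position j))))))
  where
  position : (i : Fin N) → toℕ i ∈ xs
  position i = from (h (toℕ i)) (Fin.toℕ<n i)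

nvars-canonicalCNF : ∀ N {f} → DependsBelow N f → ∀ {τ} → f τ ≡ false → nvars (canonicalCNF N f) ≡ N
nvars-canonicalCNF N {f} dep {τ} fτ = unique-length (deduplicate-! _≟_ (varList (canonicalCNF N f))) λ x →
  ⇔-trans (⇔-sym (deduplicate-∈⇔ _≟_)) (canonicalCNF-vars N {f} dep {τ} fτ x)

-- Generic in the relation: `≤` yields a maximum, its converse a minimum.
extremum : ∀ {_≲_ : ℕ → ℕ → Set} → (∀ x y → x ≲ y ⊎ y ≲ x) → (∀ {x y z} → x ≲ y → y ≲ z → x ≲ z) →
           ∀ {n} (g : Fin (suc n) → ℕ) → ∃ λ i → ∀ j → g j ≲ g i
extremum {_≲_} total ≲-trans = go
  where
  ≲-refl : ∀ {x} → x ≲ x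
  ≲-refl {x} with total x x
  ... | inj₁ p = p
  ... | inj₂ p = p

  go : ∀ {n} (g : Fin (suc n) → ℕ) → ∃ λ i → ∀ j → g j ≲ g i
  go {zero}  g = zero , λ where zero → ≲-refl
  go {suc n} g with i , max ← go (g ∘ suc) with total (g zero) (g (suc i))
  ... | inj₁ le = suc i , λ where zero    → le
                                  (suc j) → max j
  ... | inj₂ ge = zero , λ where zero    → ≲-refl
                                 (suc j) → ≲-trans (max j) ge

-- The grid function and its CNF.

module Grid (m : ℕ) where

  side : ℕ
  side = suc m

  cells : ℕ
  cells = side * side

  Line : Set
  Line = Fin side

  -- Variable 0 is the selector.  Lines are rows for true and columns for false.
  cell : Bool → Line → Line → ℕ
  cell true  k i = suc (toℕ (combine k i))
  cell false k i = suc (toℕ (combine i k))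

  -- Transposition: the pivot can be named from either of the two lines that meet in it.
  cell-not : ∀ b k i → cell (not b) k i ≡ cell b i k
  cell-not true  k i = refl
  cell-not false k i = refl

  cell-injective : ∀ b {k i k′ i′} → cell b k i ≡ cell b k′ i′ → k ≡ k′ × i ≡ i′
  cell-injective true eq =
    Fin.combine-injective _ _ _ _ (Fin.toℕ-injective (ℕ.suc-injective eq))
  cell-injective false eq with p , q ← cell-injective true eq = q , p

  cell< : ∀ b k i → cell b k i < suc cells
  cell< true  k i = s≤s (Fin.toℕ<n (combine k i))
  cell< false k i = s≤s (Fin.toℕ<n (combine i k))

  0≢cell : ∀ b {k i} → 0 ≢ cell b k i
  0≢cell true  ()
  0≢cell false ()

  cell-surjective : ∀ {x} → x < cells → ∃₂ λ k i → cell true k i ≡ suc x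
  cell-surjective x< with k , i , eq ← Fin.combine-surjective (fromℕ< x<) =
    k , i , cong suc (trans (cong toℕ eq) (Fin.toℕ-fromℕ< x<))

  HasLine : Bool → TotalAssignment → Set
  HasLine b τ = ∃ λ k → ∀ i → τ (cell b k i) ≡ true

  F : TotalAssignment → Set
  F τ = HasLine (τ 0) τ

  opaque
    F? : ∀ τ → Dec (F τ)
    F? τ = Fin.any? λ k → Fin.all? λ i → τ (cell (τ 0) k i) Bool.≟ true

  f : TotalAssignment → Bool
  f τ = ⌊ F? τ ⌋

  f⇔F : ∀ τ → f τ ≡ true ⇔ F τ
  f⇔F τ with F? τ
  ... | yes p = mk⇔ (λ _ → p) (λ _ → refl)
  ... | no ¬p = mk⇔ (λ ()) (λ p → contradiction p ¬p)

  F-cong : ∀ {τ τ′} → (∀ x → x < suc cells → τ x ≡ τ′ x) → F τ → F τ′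
  F-cong {τ} {τ′} eq (k , ones) rewrite eq 0 (s≤s z≤n) =
    k , λ i → trans (sym (eq _ (cell< (τ′ 0) k i))) (ones i)

  f-dependsBelow : DependsBelow (suc cells) f
  f-dependsBelow {τ} {τ′} eq with F? τ | F? τ′
  ... | yes _ | yes _ = refl
  ... | no _  | no _  = refl
  ... | yes p | no ¬q = contradiction (F-cong eq p) ¬q
  ... | no ¬p | yes q = contradiction (F-cong (λ x x< → sym (eq x x<)) q) ¬p

  f-false : f (λ _ → false) ≡ false
  f-false with F? (λ _ → false)
  ... | no _           = refl
  ... | yes (_ , ones) with () ← ones zero

  opaque
    -- The exponentially long formula enters the rest of the proof only through its variables, their
    -- number, and the function it computes.
    φ : CNF
    φ = canonicalCNF (suc cells) f

    φ-vars : ∀ x → InVar φ x ⇔ x < suc cells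
    φ-vars = canonicalCNF-vars (suc cells) {f} f-dependsBelow {λ _ → false} f-false

    nvars-φ : nvars φ ≡ suc cells
    nvars-φ = nvars-canonicalCNF (suc cells) {f} f-dependsBelow {λ _ → false} f-false

    φ⇔F : ∀ τ → evalCNF φ τ ≡ true ⇔ F τ
    φ⇔F τ = subst (λ b → b ≡ true ⇔ F τ)
      (sym (canonicalCNF-correct (suc cells) {f} f-dependsBelow τ)) (f⇔F τ)

  -- Indexing `g` by the lines of kind `d` lets one lower bound serve rows and columns. Variables
  -- beyond the grid default to false.
  assign : Bool → Bool → (Line → Line → Bool) → TotalAssignment
  assign _ b g zero = b
  assign d b g (suc x) with x <? cells
  ... | no _   = false
  ... | yes x< = uncurry (if d then g else flip g) (remQuot side (fromℕ< x<))

  assign-cell : ∀ d b g k i → assign d b g (cell d k i) ≡ g k i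
  assign-cell true b g k i with toℕ (combine k i) <? cells
  ... | no ≮   = contradiction (Fin.toℕ<n (combine k i)) ≮
  ... | yes lt = cong (uncurry g) (trans (cong (remQuot side) (Fin.fromℕ<-toℕ (combine k i) lt))
                                         (Fin.remQuot-combine k i))
  assign-cell false b g k i with toℕ (combine i k) <? cells
  ... | no ≮   = contradiction (Fin.toℕ<n (combine i k)) ≮
  ... | yes lt = cong (uncurry (flip g)) (trans (cong (remQuot side) (Fin.fromℕ<-toℕ (combine i k) lt))
                                                (Fin.remQuot-combine i k))

  -- The first completed line and the size bound.

  module _ (B : Diagram) (B-obdd : IsAndOBDD B) (rep : Represents B φ) where
    private
      B-fbdd = proj₁ B-obdd
      π = proj₁ (proj₂ B-obdd)
      π-injective = proj₁ (proj₂ (proj₂ B-obdd))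
      ordered = proj₂ (proj₂ (proj₂ B-obdd))

    source-F : ∀ τ → Sat B τ (source B) ⇔ F τ
    source-F τ = ⇔-trans
      (mk⇔ (λ p → let a , α , ext , _ = sat⇒accepted B-fbdd p in proj₂ (proj₂ rep τ) (a , α , ext))
           (λ e → let a , α , ext = proj₁ (proj₂ rep τ) e in accepted⇒sat α ext))
      (φ⇔F τ)

    last : ∀ b → Line → Line
    last b k = proj₁ (extremum ℕ.≤-total ℕ.≤-trans (λ i → π (cell b k i)))

    last-max : ∀ b k i → π (cell b k i) ≤ π (cell b k (last b k))
    last-max b k = proj₂ (extremum ℕ.≤-total ℕ.≤-trans (λ i → π (cell b k i)))

    first : ∀ b → ∃ λ r → ∀ k → π (cell b r (last b r)) ≤ π (cell b k (last b k))
    first b = extremum {λ x y → y ≤ x} (flip ℕ.≤-total) (flip ℕ.≤-trans) (λ k → π (cell b k (last b k)))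

    -- The line completed first when the variables are read in the order π.
    firstComplete : ∃ λ b → ∃ λ r → ∀ b′ k → π (cell b r (last b r)) ≤ π (cell b′ k (last b′ k))
    firstComplete with r₀ , min₀ ← first false with r₁ , min₁ ← first true
      with ℕ.≤-total (π (cell false r₀ (last false r₀))) (π (cell true r₁ (last true r₁)))
    ... | inj₁ le = false , r₀ , λ where false k → min₀ k
                                         true  k → ℕ.≤-trans le (min₁ k)
    ... | inj₂ ge = true , r₁ , λ where false k → ℕ.≤-trans ge (min₀ k)
                                        true  k → min₁ k

    obdd-size : 2 ^ m ≤ size B
    obdd-size with b , r , min ← firstComplete =
      -- The selected kind `not b` crosses the completed line `r`. The pivot is the last variable of
      -- `r`, through which the crossing line `last b r` passes.
      LowerBound.lower-bound 0 (cell (not b)) (proj₂ ∘ cell-injective (not b)) (0≢cell (not b))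
        (assign (not b)) (λ _ _ → refl) (assign-cell (not b)) F (not b)
        (λ {τ} eq → subst (λ d → F τ ⇔ HasLine d τ) eq (mk⇔ (λ p → p) (λ p → p)))
        B B-fbdd source-F π ordered (last b r) r touched incomplete
      where
      c = last b r

      -- Line `k` meets `r` in a variable other than the last one of `r`; injectivity of `π` makes
      -- the comparison strict.
      touched : ∀ k → k ≢ c → ∃ λ i → π (cell (not b) k i) < π (cell (not b) c r)
      touched k k≢c = r , ℕ.≤∧≢⇒<
        (subst₂ (λ x y → π x ≤ π y) (sym (cell-not b k r)) (sym (cell-not b c r)) (last-max b r k))
        (k≢c ∘ proj₁ ∘ cell-injective (not b) ∘ π-injective)

      -- No line is completed before `r`, so the last variable of `k` is a witness.
      incomplete : ∀ k → ∃ λ i → π (cell (not b) c r) ≤ π (cell (not b) k i)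
      incomplete k = last (not b) k ,
        subst (λ x → π x ≤ π (cell (not b) k (last (not b) k))) (sym (cell-not b c r)) (min (not b) k)

-- The FBDD that reads the grid line by line.

module FBDD (m : ℕ) where
  open Grid m

  -- A path from the root reaches `body b k i` when every earlier line has shown a zero and line `k`
  -- has shown only ones before `i`. The current cell is thus all the memory required.
  data Position : Set where
    root : Position
    body : Bool → Line → Line → Position
    end  : Bool → Position

  nodes : ℕ
  nodes = suc (2 * cells + 2)

  opaque
    -- Root first, then the cells of each kind in reading order, then the sinks, so that all edges
    -- go upwards.
    ⟦_⟧ : Position → Fin nodes
    ⟦ root ⟧       = zero
    ⟦ body b k i ⟧ = suc (combine (bit b) (combine k i) ↑ˡ 2)
    ⟦ end b ⟧      = suc ((2 * cells) ↑ʳ bit b)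

    position : Fin nodes → Position
    position zero    = root
    position (suc u) =
      [ (λ w → let b , w′ = remQuot cells w in uncurry (body (unbit b)) (remQuot side w′))
      , end ∘ unbit ]′ (splitAt (2 * cells) u)

    position-⟦⟧ : ∀ p → position ⟦ p ⟧ ≡ p
    position-⟦⟧ root = refl
    position-⟦⟧ (end b) rewrite Fin.splitAt-↑ʳ (2 * cells) 2 (bit b) = cong end (unbit-bit b)
    position-⟦⟧ (body b k i) =
      trans (cong [ _ , _ ]′ (Fin.splitAt-↑ˡ (2 * cells) (combine (bit b) (combine k i)) 2))
        (trans (cong (λ (b , w) → uncurry (body (unbit b)) (remQuot side w))
                 (Fin.remQuot-combine (bit b) (combine k i)))
          (trans (cong (uncurry (body (unbit (bit b)))) (Fin.remQuot-combine k i))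
            (cong (λ b → body b k i) (unbit-bit b))))

    ⟦⟧-position : ∀ u → ⟦ position u ⟧ ≡ u
    ⟦⟧-position zero = refl
    ⟦⟧-position (suc u) with splitAt (2 * cells) u in eq
    ... | inj₁ w = cong suc (trans (cong (_↑ˡ 2)
            (trans (cong₂ combine (bit-unbit (proj₁ (remQuot {2} cells w)))
                           (Fin.combine-remQuot {side} side (proj₂ (remQuot {2} cells w))))
                   (Fin.combine-remQuot {2} cells w)))
            (trans (cong (Fin.join (2 * cells) 2) (sym eq)) (Fin.join-splitAt (2 * cells) 2 u)))
    ... | inj₂ e = cong suc (trans (cong ((2 * cells) ↑ʳ_) (bit-unbit e))
            (trans (cong (Fin.join (2 * cells) 2) (sym eq)) (Fin.join-splitAt (2 * cells) 2 u)))

    ⟦root⟧ : ⟦ root ⟧ ≡ zero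
    ⟦root⟧ = refl

    root<body : ∀ b k i → toℕ ⟦ root ⟧ < toℕ ⟦ body b k i ⟧
    root<body b k i = s≤s z≤n

    body<end : ∀ b k i e → toℕ ⟦ body b k i ⟧ < toℕ ⟦ end e ⟧
    body<end b k i e = s≤s (ℕ.≤-trans
      (ℕ.≤-trans (s≤s (ℕ.≤-reflexive (Fin.toℕ-↑ˡ w 2))) (Fin.toℕ<n w))
      (ℕ.≤-trans (ℕ.m≤m+n (2 * cells) _) (ℕ.≤-reflexive (sym (Fin.toℕ-↑ʳ (2 * cells) (bit e))))))
      where
      w : Fin (2 * cells)
      w = combine (bit b) (combine k i)

    body<body : ∀ b {k i k′ i′} → toℕ (combine k i) < toℕ (combine k′ i′) →
                toℕ ⟦ body b k i ⟧ < toℕ ⟦ body b k′ i′ ⟧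
    body<body b {k} {i} {k′} {i′} lt = s≤s (subst₂ _<_
      (sym (Fin.toℕ-↑ˡ (combine (bit b) (combine k i)) 2))
      (sym (Fin.toℕ-↑ˡ (combine (bit b) (combine k′ i′)) 2))
      (subst₂ _<_ (sym (Fin.toℕ-combine (bit b) (combine k i)))
                  (sym (Fin.toℕ-combine (bit b) (combine k′ i′)))
        (ℕ.+-monoʳ-< (cells * toℕ (bit b)) lt)))

  -- A zero settles the current line, so the rest of it is skipped.
  nextLine : Bool → Line → Position
  nextLine b k with view k
  ... | ‵fromℕ     = end false
  ... | ‵inject₁ k = body b (suc k) zero

  nextCell : Bool → Line → Line → Position
  nextCell b k i with view i
  ... | ‵fromℕ     = end true
  ... | ‵inject₁ i = body b k (suc i)

  nextLine-inject₁ : ∀ b k → nextLine b (inject₁ k) ≡ body b (suc k) zero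
  nextLine-inject₁ b k rewrite view-inject₁ k = refl

  nextLine-fromℕ : ∀ b → nextLine b (fromℕ m) ≡ end false
  nextLine-fromℕ b rewrite view-fromℕ m = refl

  nextCell-inject₁ : ∀ b k i → nextCell b k (inject₁ i) ≡ body b k (suc i)
  nextCell-inject₁ b k i rewrite view-inject₁ i = refl

  nextCell-fromℕ : ∀ b k → nextCell b k (fromℕ m) ≡ end true
  nextCell-fromℕ b k rewrite view-fromℕ m = refl

  nodeAt : Position → Node nodes
  nodeAt root         = dec 0 ⟦ body false zero zero ⟧ ⟦ body true zero zero ⟧
  nodeAt (body b k i) = dec (cell b k i) ⟦ nextLine b k ⟧ ⟦ nextCell b k i ⟧
  nodeAt (end b)      = sink b

  fbdd : Diagram
  fbdd = record { n = 2 * cells + 2 ; node = nodeAt ∘ position }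

  node-⟦⟧ : ∀ p → node fbdd ⟦ p ⟧ ≡ nodeAt p
  node-⟦⟧ p = cong nodeAt (position-⟦⟧ p)

  ⟦⟧-ind : (P : Fin nodes → Set) → (∀ p → P ⟦ p ⟧) → ∀ u → P u
  ⟦⟧-ind P h u = subst P (⟦⟧-position u) (h (position u))

  child⁻ : ∀ p {j} → Child fbdd ⟦ p ⟧ j → ChildN (nodeAt p) j
  child⁻ p {j} = subst (λ N → ChildN N j) (node-⟦⟧ p)

  child⁺ : ∀ p {j} → ChildN (nodeAt p) j → Child fbdd ⟦ p ⟧ j
  child⁺ p {j} = subst (λ N → ChildN N j) (sym (node-⟦⟧ p))

  body<nextLine : ∀ b k i → toℕ ⟦ body b k i ⟧ < toℕ ⟦ nextLine b k ⟧
  body<nextLine b k i with view k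
  ... | ‵fromℕ     = body<end b _ i false
  ... | ‵inject₁ k = body<body b (Fin.combine-monoˡ-< i zero (s≤s (ℕ.≤-reflexive (Fin.toℕ-inject₁ k))))

  body<nextCell : ∀ b k i → toℕ ⟦ body b k i ⟧ < toℕ ⟦ nextCell b k i ⟧
  body<nextCell b k i with view i
  ... | ‵fromℕ     = body<end b k _ true
  ... | ‵inject₁ i = body<body b (subst₂ _<_
      (sym (Fin.toℕ-combine k (inject₁ i))) (sym (Fin.toℕ-combine k (suc i)))
      (ℕ.+-monoʳ-< (side * toℕ k) (s≤s (ℕ.≤-reflexive (Fin.toℕ-inject₁ i)))))

  acyclic : ∀ i j → Child fbdd i j → toℕ i < toℕ j
  acyclic = ⟦⟧-ind _ λ p j c → go p j (child⁻ p c)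
    where
    go : ∀ p j → ChildN (nodeAt p) j → toℕ ⟦ p ⟧ < toℕ j
    go root         _ (inj₁ refl) = root<body _ _ _
    go root         _ (inj₂ refl) = root<body _ _ _
    go (body b k i) _ (inj₁ refl) = body<nextLine b k i
    go (body b k i) _ (inj₂ refl) = body<nextCell b k i

  reach-≤ : ∀ {i j} → Reach fbdd i j → toℕ i ≤ toℕ j
  reach-≤ here        = ℕ.≤-refl
  reach-≤ (there c r) = ℕ.≤-trans (ℕ.<⇒≤ (acyclic _ _ c)) (reach-≤ r)

  reach-snoc : ∀ {i j k} → Reach fbdd i j → Child fbdd j k → Reach fbdd i k
  reach-snoc here        c = there c here
  reach-snoc (there d r) c = there d (reach-snoc r c)

  -- Along the heads of the lines by 0-edges, then along line `k` by 1-edges.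
  reach-body : ∀ b k i → Reach fbdd ⟦ root ⟧ ⟦ body b k i ⟧
  reach-body b = λ k → Fin.<-weakInduction (λ i → Reach fbdd ⟦ root ⟧ ⟦ body b k i ⟧) (reach-line k)
      λ i r → reach-snoc r (child⁺ (body b k (inject₁ i))
                (inj₂ (cong ⟦_⟧ (sym (nextCell-inject₁ b k i)))))
    where
    start : ∀ b → ⟦ body b zero zero ⟧ ≡ ⟦ body false zero zero ⟧ ⊎ ⟦ body b zero zero ⟧ ≡ ⟦ body true zero zero ⟧
    start false = inj₁ refl
    start true  = inj₂ refl

    reach-line : ∀ k → Reach fbdd ⟦ root ⟧ ⟦ body b k zero ⟧
    reach-line = Fin.<-weakInduction (λ k → Reach fbdd ⟦ root ⟧ ⟦ body b k zero ⟧)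
      (there (child⁺ root (start b)) here)
      λ k r → reach-snoc r (child⁺ (body b (inject₁ k) zero)
                (inj₁ (cong ⟦_⟧ (sym (nextLine-inject₁ b k)))))

  reach : ∀ p → Reach fbdd ⟦ root ⟧ ⟦ p ⟧
  reach root         = here
  reach (body b k i) = reach-body b k i
  reach (end false)  = reach-snoc (reach-body true (fromℕ m) zero)
    (child⁺ (body true (fromℕ m) zero) (inj₁ (cong ⟦_⟧ (sym (nextLine-fromℕ true)))))
  reach (end true)   = reach-snoc (reach-body true zero (fromℕ m))
    (child⁺ (body true zero (fromℕ m)) (inj₂ (cong ⟦_⟧ (sym (nextCell-fromℕ true zero)))))

  -- Each grid variable labels one node of either kind, so read-once rests on paths never crossing
  -- from one kind to the other.
  data Branch (b : Bool) : Position → Set where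
    in-body : ∀ k i → Branch b (body b k i)
    in-end  : ∀ e → Branch b (end e)

  branch-nextLine : ∀ b k → Branch b (nextLine b k)
  branch-nextLine b k with view k
  ... | ‵fromℕ     = in-end false
  ... | ‵inject₁ k = in-body (suc k) zero

  branch-nextCell : ∀ b k i → Branch b (nextCell b k i)
  branch-nextCell b k i with view i
  ... | ‵fromℕ     = in-end true
  ... | ‵inject₁ i = in-body k (suc i)

  branch-reach : ∀ {b p u} → Branch b p → Reach fbdd ⟦ p ⟧ u → ∃ λ q → Branch b q × u ≡ ⟦ q ⟧
  branch-reach br here = _ , br , refl
  branch-reach {b} (in-body k i) (there c r) with child⁻ (body b k i) c
  ... | inj₁ refl = branch-reach (branch-nextLine b k) r
  ... | inj₂ refl = branch-reach (branch-nextCell b k i) r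
  branch-reach (in-end e) (there c r) = ⊥-elim (child⁻ (end e) c)

  -- Numbers grow along paths. With `body<nextLine` and `body<nextCell`, the bound keeps the current
  -- cell from being read again below its children.
  varAt-branch : ∀ {b p x} → Branch b p → VarAt fbdd ⟦ p ⟧ x →
                 ∃₂ λ k i → cell b k i ≡ x × toℕ ⟦ p ⟧ ≤ toℕ ⟦ body b k i ⟧
  varAt-branch {x = x} br (j , r , l) with branch-reach br r
  ... | body b k i , in-body _ _ , refl = k , i , subst (λ N → LabelN N x) (node-⟦⟧ (body b k i)) l , reach-≤ r
  ... | end e , in-end _ , refl = ⊥-elim (subst (λ N → LabelN N x) (node-⟦⟧ (end e)) l)

  isFBDD : IsFBDD fbdd
  isFBDD = record
    { acyclic      = acyclic
    ; singleSource = ⟦⟧-ind _ λ p → subst (λ u → Reach fbdd u ⟦ p ⟧) ⟦root⟧ (reach p)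
    ; sinks        = λ i j b e e′ → trans (sink-end i b e) (sym (sink-end j b e′))
    ; decomposable = λ i _ _ e → ⊥-elim (not-conj (position i) e)
    ; readOnce     = ⟦⟧-ind _ λ p x u₀ u₁ e → readOnce p (trans (sym (node-⟦⟧ p)) e)
    } , λ i _ _ → not-conj (position i)
    where
    not-conj : ∀ p {u₀ u₁} → nodeAt p ≢ conj u₀ u₁
    not-conj root         ()
    not-conj (body _ _ _) ()
    not-conj (end _)      ()

    sink-end : ∀ u b → node fbdd u ≡ sink b → u ≡ ⟦ end b ⟧
    sink-end u b e with position u in eq
    sink-end u b refl | end _ = trans (sym (⟦⟧-position u)) (cong ⟦_⟧ eq)

    unread : ∀ b k i {p} → Branch b p → toℕ ⟦ body b k i ⟧ < toℕ ⟦ p ⟧ → ¬ VarAt fbdd ⟦ p ⟧ (cell b k i)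
    unread b k i br lt m with k′ , i′ , eq , le ← varAt-branch br m
                         with refl , refl ← cell-injective b eq = ℕ.<⇒≱ lt le

    root-unread : ∀ b → ¬ VarAt fbdd ⟦ body b zero zero ⟧ 0
    root-unread b m with _ , _ , eq , _ ← varAt-branch (in-body zero zero) m = 0≢cell b (sym eq)

    readOnce : ∀ p {x u₀ u₁} → nodeAt p ≡ dec x u₀ u₁ → ¬ VarAt fbdd u₀ x × ¬ VarAt fbdd u₁ x
    readOnce root refl = root-unread false , root-unread true
    readOnce (body b k i) refl =
      unread b k i (branch-nextLine b k) (body<nextLine b k i) ,
      unread b k i (branch-nextCell b k i) (body<nextCell b k i)

  label-⟦⟧ : ∀ p {x} → LabelN (nodeAt p) x → VarB fbdd x
  label-⟦⟧ p {x} l = ⟦ p ⟧ , subst (λ u → Reach fbdd u ⟦ p ⟧) ⟦root⟧ (reach p) ,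
                     subst (λ N → LabelN N x) (sym (node-⟦⟧ p)) l

  varB-fbdd : ∀ x → VarB fbdd x ⇔ x < suc cells
  varB-fbdd x = mk⇔ (λ (j , _ , l) → below (position j) l) (above x)
    where
    below : ∀ p {x} → LabelN (nodeAt p) x → x < suc cells
    below root         refl = s≤s z≤n
    below (body b k i) refl = cell< b k i

    above : ∀ x → x < suc cells → VarB fbdd x
    above zero    _        = label-⟦⟧ root refl
    above (suc x) (s≤s x<) with k , i , eq ← cell-surjective x< = label-⟦⟧ (body true k i) eq

  -- Correctness of the FBDD.

  module _ (τ : TotalAssignment) where

    Suffix : Bool → Line → Line → Set
    Suffix b k i = ∀ i′ → i Fin.≤ i′ → τ (cell b k i′) ≡ true

    sat-end : ∀ {u b} → u ≡ ⟦ end b ⟧ → Sat fbdd τ u → b ≡ true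
    sat-end {b = b} refl (sat-one e) with refl ← trans (sym (node-⟦⟧ (end b))) e = refl
    sat-end {b = b} refl (sat-dec e _) with () ← trans (sym (node-⟦⟧ (end b))) e
    sat-end {b = b} refl (sat-conj e _ _) with () ← trans (sym (node-⟦⟧ (end b))) e

    suffix-fromℕ : ∀ b k → τ (cell b k (fromℕ m)) ≡ true → Suffix b k (fromℕ m)
    suffix-fromℕ b k eq i′ le =
      subst (λ i → τ (cell b k i) ≡ true) (Fin.≤-antisym le (Fin.≤fromℕ i′)) eq

    suffix-inject₁ : ∀ b k {i} → τ (cell b k (inject₁ i)) ≡ true → Suffix b k (suc i) →
                     Suffix b k (inject₁ i)
    suffix-inject₁ b k {i} eq suf i′ le with inject₁ i Fin.≟ i′
    ... | yes refl = eq
    ... | no i≢i′  = suf i′ (subst (_< toℕ i′) (Fin.toℕ-inject₁ i) (ℕ.≤∧≢⇒< le (i≢i′ ∘ Fin.toℕ-injective)))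

    -- The node does not record the cells of line `k` before `i`, so only a suffix is claimed there.
    -- From the head of a later line the suffix is the full line.
    sound-body : ∀ {u b} k i → u ≡ ⟦ body b k i ⟧ → Sat fbdd τ u → Suffix b k i ⊎ HasLine b τ
    sound-body {b = b} k i refl (sat-one e) with () ← trans (sym (node-⟦⟧ (body b k i))) e
    sound-body {b = b} k i refl (sat-conj e _ _) with () ← trans (sym (node-⟦⟧ (body b k i))) e
    sound-body {b = b} k i refl (sat-dec e p)
      with refl , refl , refl ← dec-injective (trans (sym e) (node-⟦⟧ (body b k i)))
      with τ (cell b k i) in eq | view k | view i
    ... | false | ‵fromℕ      | _           = contradiction (sat-end refl p) λ ()
    ... | false | ‵inject₁ k′ | _           =
      inj₂ ([ (λ suf → suc k′ , λ i → suf i z≤n) , id ]′ (sound-body (suc k′) zero refl p))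
    ... | true  | _           | ‵fromℕ      = inj₁ (suffix-fromℕ b k eq)
    ... | true  | _           | ‵inject₁ i′ =
      map₁ (suffix-inject₁ b k eq) (sound-body k (suc i′) refl p)

    sound : ∀ b → Sat fbdd τ ⟦ body b zero zero ⟧ → HasLine b τ
    sound b p with sound-body zero zero refl p
    ... | inj₁ suf = zero , λ i → suf i z≤n
    ... | inj₂ h   = h

    sat-end-true : Sat fbdd τ ⟦ end true ⟧
    sat-end-true = sat-one (node-⟦⟧ (end true))

    -- Backward along the line: ones lead on to `end true`, a zero leaves for the next line. Asking
    -- for `next` only at zeros makes it vacuous on a line of ones.
    sat-line : ∀ b k → (∀ i → τ (cell b k i) ≡ false → Sat fbdd τ ⟦ nextLine b k ⟧) →
               ∀ i → Sat fbdd τ ⟦ body b k i ⟧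
    sat-line b k next = Fin.>-weakInduction _
      (step (fromℕ m) (subst (λ p → Sat fbdd τ ⟦ p ⟧) (sym (nextCell-fromℕ b k)) sat-end-true))
      (λ i p → step (inject₁ i) (subst (λ p → Sat fbdd τ ⟦ p ⟧) (sym (nextCell-inject₁ b k i)) p))
      where
      step : ∀ i → Sat fbdd τ ⟦ nextCell b k i ⟧ → Sat fbdd τ ⟦ body b k i ⟧
      step i p = sat-dec (node-⟦⟧ (body b k i)) (choose (τ (cell b k i)) refl)
        where
        choose : ∀ c → τ (cell b k i) ≡ c →
                 Sat fbdd τ (if c then ⟦ nextCell b k i ⟧ else ⟦ nextLine b k ⟧)
        choose true  _  = p
        choose false eq = next i eq

    complete : ∀ b → HasLine b τ → Sat fbdd τ ⟦ body b zero zero ⟧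
    complete b (l , ones) = from-line zero z≤n zero
      where
      skip : ∀ {k} → k ≡ l → ∀ i → τ (cell b k i) ≢ false
      skip refl i eq with () ← trans (sym (ones i)) eq

      -- Backward induction over the lines up to `l`: at `l` no zero occurs, and before `l` the next
      -- line is still at most `l`.
      from-line : ∀ k → k Fin.≤ l → ∀ i → Sat fbdd τ ⟦ body b k i ⟧
      from-line = Fin.>-weakInduction _
        (λ le → sat-line b (fromℕ m) λ i eq →
          contradiction eq (skip (Fin.≤-antisym le (Fin.≤fromℕ l)) i))
        λ k later le → sat-line b (inject₁ k) λ i eq →
          subst (λ p → Sat fbdd τ ⟦ p ⟧) (sym (nextLine-inject₁ b k))
            (later (subst (_< toℕ l) (Fin.toℕ-inject₁ k)
              (ℕ.≤∧≢⇒< le (λ eq′ → skip (Fin.toℕ-injective eq′) i eq))) zero)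

    sat-root : Sat fbdd τ ⟦ root ⟧ ⇔ F τ
    sat-root = mk⇔
      (λ p → sound (τ 0) (subst (Sat fbdd τ) (branch (τ 0)) (sat-dec⁻ (node-⟦⟧ root) p)))
      (λ h → sat-dec (node-⟦⟧ root) (subst (Sat fbdd τ) (sym (branch (τ 0))) (complete (τ 0) h)))
      where
      branch : ∀ b → (if b then ⟦ body true zero zero ⟧ else ⟦ body false zero zero ⟧) ≡ ⟦ body b zero zero ⟧
      branch false = refl
      branch true  = refl

  represents : Represents fbdd φ
  represents =
    (λ x → let e = ⇔-trans (varB-fbdd x) (⇔-sym (φ-vars x)) in to e , from e) ,
    λ τ → let e = ⇔-trans (φ⇔F τ) (subst (λ u → F τ ⇔ Sat fbdd τ u) ⟦root⟧ (⇔-sym (sat-root τ))) in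
      (λ t → let a , α , ext , _ = sat⇒accepted (proj₁ isFBDD) (to e t) in a , α , ext) ,
      (λ (a , α , ext) → from e (accepted⇒sat α ext))

  -- There are `2 * cells + 3` nodes and `cells + 1` variables.
  fbdd-size : size fbdd ≤ 2 * nvars φ ^ 1 + 2
  fbdd-size = subst (λ N → size fbdd ≤ 2 * N ^ 1 + 2) (sym nvars-φ) (linear cells)
    where
    linear : ∀ N → suc (2 * N + 2) ≤ 2 * suc N ^ 1 + 2
    linear N = begin
      suc (2 * N + 2)     ≤⟨ ℕ.n≤1+n _ ⟩
      2 + 2 * N + 2       ≡⟨ cong (_+ 2) (sym (ℕ.*-suc 2 N)) ⟩
      2 * suc N + 2       ≡⟨ cong (λ k → 2 * k + 2) (sym (ℕ.^-identityʳ (suc N))) ⟩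
      2 * suc N ^ 1 + 2   ∎
      where open ℕ.≤-Reasoning

-- The class of CNFs and the two bounds.

open Grid

-- Sides start at 2, so that the side is at most twice the exponent, side minus one, in `obdd-size`.
Lines : CNF → Set
Lines ψ = ∃ λ m → ψ ≡ φ (suc m)

n≤cells : ∀ m → m ≤ cells m
n≤cells m = ℕ.≤-trans (ℕ.n≤1+n m) (ℕ.m≤m*n (suc m) (suc m))

-- The additional one counts the selector; the next square still exceeds the sum.
square-≤ : ∀ {k n} → k ^ 2 ≤ suc (suc n * suc n) → k ≤ suc n
square-≤ {k} {n} le = ℕ.≮⇒≥ λ n<k → ℕ.<⇒≱ (lt n<k) le
  where
  open ℕ.≤-Reasoning
  lt : suc (suc n) ≤ k → suc (suc n * suc n) < k ^ 2
  lt n<k = begin-strict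
    suc (suc n * suc n)           <⟨ s≤s (ℕ.m<n+m (suc n * suc n) {suc n} (s≤s z≤n)) ⟩
    suc (suc n + suc n * suc n)   ≡⟨ cong suc (sym (ℕ.*-suc (suc n) (suc n))) ⟩
    suc (suc n * suc (suc n))     ≤⟨ ℕ.+-monoˡ-≤ (suc n * suc (suc n)) (s≤s {n = suc n} z≤n) ⟩
    suc (suc n) * suc (suc n)     ≤⟨ ℕ.*-mono-≤ n<k n<k ⟩
    k * k                         ≡⟨ cong (k *_) (sym (ℕ.*-identityʳ k)) ⟩
    k ^ 2                         ∎

-- The exponential bound avoids real exponents: `B` has size at least 2 to the power `m / d`, where
-- `m` is the integer part of the `q`-th root of `nvars φ`. So the constant `c` is `1 / q`.
theorem2 : Σ (CNF → Set) λ Φ →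
  (∀ N → ∃ λ φ → Φ φ × N ≤ nvars φ) ×
  (∃ λ C → ∃ λ k → ∀ φ → Φ φ →
  ∃ λ B → IsFBDD B × Represents B φ × size B ≤ C * nvars φ ^ k + C) ×
  (∃ λ q → ∃ λ d → ∃ λ N₀ → 1 ≤ q × 1 ≤ d ×
  (∀ φ → Φ φ → N₀ ≤ nvars φ → ∀ B → IsAndOBDD B → Represents B φ →
  ∀ m → m ^ q ≤ nvars φ → 2 ^ m ≤ size B ^ d))
theorem2 = Lines ,
  (λ N → φ (suc N) , (N , refl) ,
    ℕ.≤-trans (ℕ.n≤1+n N) (ℕ.≤-trans (n≤cells (suc N))
      (ℕ.≤-trans (ℕ.n≤1+n _) (ℕ.≤-reflexive (sym (nvars-φ (suc N))))))) ,
  (2 , 1 , λ where ._ (m , refl) → let open FBDD (suc m) in fbdd , isFBDD , represents , fbdd-size) ,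
  -- `q = 2` because the number of variables is the squared side plus one. `d = 2` because side
  -- `n + 2` gives the exponent `n + 1`, and doubling it covers `n + 2`.
  (2 , 2 , 0 , s≤s z≤n , s≤s z≤n , λ where
    ._ (n , refl) _ B obdd rep m le →
      let open ℕ.≤-Reasoning
          bound = obdd-size (suc n) B obdd rep
      in begin
        2 ^ m                     ≤⟨ ℕ.^-monoʳ-≤ 2 (square-≤ {m} {suc n} (subst (m ^ 2 ≤_) (nvars-φ (suc n)) le)) ⟩
        2 ^ suc (suc n)           ≤⟨ ℕ.^-monoʳ-≤ 2 (s≤s (ℕ.m≤n+m (suc n) n)) ⟩
        2 ^ (suc n + suc n)       ≡⟨ ℕ.^-distribˡ-+-* 2 (suc n) (suc n) ⟩
        2 ^ suc n * 2 ^ suc n     ≤⟨ ℕ.*-mono-≤ bound bound ⟩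
        size B * size B           ≡⟨ cong (size B *_) (sym (ℕ.*-identityʳ (size B))) ⟩
        size B ^ 2                ∎)
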